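{- Classically (i.e. assuming excluded middle), for any statement $s$, state $\sigma$ and resumption $r:\mathit{res}$, if $(s,\sigma)\Rightarrow r$, then there exists a classical-style resumption $r':\mathit{res}_{\mathrm c}$ such that $(s,\sigma)\Rightarrow_{\mathrm c}r'$ and $r\cong\mathit{emb}~r'$.
   Context: Language. Given sets of variables $x$ and pure expressions $e$; values are integers; states $\sigma$ map variables to integers; $\sigma[x\mapsto v]$ is state update; $\llbracket e\rrbracket\sigma\in\mathbb Z$ is the value of $e$ in $\sigma$; $\sigma\models e$ means $\llbracket e\rrbracket\sigma\neq 0$. Statements: $s::=\mathsf{skip}\mid s_0;s_1\mid x:=e\mid\mathsf{if}~e~\mathsf{then}~s_t~\mathsf{else}~s_f\mid\mathsf{while}~e~\mathsf{do}~s_t\mid\mathsf{input}~x\mid\mathsf{output}~e$. Delayful resumptions $r:\mathit{res}$ are defined coinductively by the constructors $\mathit{ret}~\sigma$, $\mathit{in}~f$ ($f:\mathbb Z\to\mathit{res}$), $\mathit{out}~v~r$ ($v\in\mathbb Z$), $\delta~r$. Strong bisimilarity $\approx$ is defined coinductively: $\mathit{ret}~\sigma\approx\mathit{ret}~\sigma$; $\mathit{in}~f\approx\mathit{in}~f_*$ if $\forall v.\,f\,v\approx f_*\,v$; $\mathit{out}~v~r\approx\mathit{out}~v~r_*$ if $r\approx r_*$; $\delta~r\approx\delta~r_*$ if $r\approx r_*$. Classical-style resumptions $r:\mathit{res}_{\mathrm c}$ are defined coinductively by constructors $\mathit{ret}_{\mathrm c}~\sigma$, $\mathit{in}_{\mathrm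 c}~f$ ($f:\mathbb Z\to\mathit{res}_{\mathrm c}$), $\mathit{out}_{\mathrm c}~v~r$ ($v\in\mathbb Z$), and the constant $\bullet$ (silent divergence), with strong bisimilarity $\approx$ defined coinductively by the analogous congruence rules and $\bullet\approx\bullet$. Strongly bisimilar resumptions count as equal (setoids with equality $\approx$), and all relations on resumptions are understood to respect $\approx$. The embedding $\mathit{emb}:\mathit{res}_{\mathrm c}\to\mathit{res}$ is defined corecursively: $\mathit{emb}(\mathit{ret}_{\mathrm c}~\sigma)=\mathit{ret}~\sigma$, $\mathit{emb}(\mathit{in}_{\mathrm c}~f)=\mathit{in}(\lambda v.\,\mathit{emb}(f\,v))$, $\mathit{emb}(\mathit{out}_{\mathrm c}~v~r)=\mathit{out}~v~(\mathit{emb}~r)$, $\mathit{emb}~\bullet=\delta(\mathit{emb}~\bullet)$. Convergence $r\downarrow r'$ on $\mathit{res}$ is inductive: $\mathit{ret}~\sigma\downarrow\mathit{ret}~\sigma$; $\mathit{in}~f\downarrow\mathit{in}~f_*$ if $\forall v.\,f\,v\approx f_*\,v$; $\mathit{out}~v~r\downarrow\mathit{out}~v~r_*$ if $r\approx r_*$; $\delta~r\downarrow r'$ if $r\downarrow r'$. Weak bisimilarity $r\cong r_*$ on $\mathit{res}$ is coinductive: (1) $r\cong r_*$ if $r\downarrow\mathit{ret}~\sigma$ and $r_*\downarrow\mathit{ret}~\sigma$; (2) $r\cong r_*$ if $r\downarrow\mathit{in}~f$, $r_*\downarrow\mathit{in}~f_*$ and $\forall v.\,f\,v\cong f_*\,v$;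 (3) $r\cong r_*$ if $r\downarrow\mathit{out}~v~r'$, $r_*\downarrow\mathit{out}~v~r_*'$ and $r'\cong r'_*$; (4) $\delta~r\cong\delta~r_*$ if $r\cong r_*$. Delayful big-step semantics. Evaluation $(s,\sigma)\Rightarrow r$ and its extended evaluation, written here $(s,r)\Rightarrow^{\mathrm{ext}}r'$ (on $\mathit{res}$), are defined mutually coinductively by: $(x:=e,\sigma)\Rightarrow\delta(\mathit{ret}~\sigma[x\mapsto\llbracket e\rrbracket\sigma])$; $(\mathsf{skip},\sigma)\Rightarrow\mathit{ret}~\sigma$; $(s_0;s_1,\sigma)\Rightarrow r'$ if $(s_0,\sigma)\Rightarrow r$ and $(s_1,r)\Rightarrow^{\mathrm{ext}}r'$; $(\mathsf{if}~e~\mathsf{then}~s_t~\mathsf{else}~s_f,\sigma)\Rightarrow r$ if either $\sigma\models e$ and $(s_t,\delta(\mathit{ret}~\sigma))\Rightarrow^{\mathrm{ext}}r$, or $\sigma\not\models e$ and $(s_f,\delta(\mathit{ret}~\sigma))\Rightarrow^{\mathrm{ext}}r$; $(\mathsf{while}~e~\mathsf{do}~s_t,\sigma)\Rightarrow r'$ if $\sigma\models e$, $(s_t,\delta(\mathit{ret}~\sigma))\Rightarrow^{\mathrm{ext}}r$ and $(\mathsf{while}~e~\mathsf{do}~s_t,r)\Rightarrow^{\mathrm{ext}}r'$; $(\mathsf{while}~e~\mathsf{do}~s_t,\sigma)\Rightarrow\delta(\mathit{ret}~\sigma)$ if $\sigma\not\models e$; $(\mathsf{input}~x,\sigma)\Rightarrow\mathit{in}(\lambda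 v.\,\mathit{ret}~\sigma[x\mapsto v])$; $(\mathsf{output}~e,\sigma)\Rightarrow\mathit{out}~(\llbracket e\rrbracket\sigma)~(\mathit{ret}~\sigma)$; $(s,\mathit{ret}~\sigma)\Rightarrow^{\mathrm{ext}}r$ if $(s,\sigma)\Rightarrow r$; $(s,\mathit{in}~f)\Rightarrow^{\mathrm{ext}}\mathit{in}~f'$ if $\forall v.\,(s,f\,v)\Rightarrow^{\mathrm{ext}}f'\,v$; $(s,\mathit{out}~v~r)\Rightarrow^{\mathrm{ext}}\mathit{out}~v~r'$ if $(s,r)\Rightarrow^{\mathrm{ext}}r'$; $(s,\delta~r)\Rightarrow^{\mathrm{ext}}\delta~r'$ if $(s,r)\Rightarrow^{\mathrm{ext}}r'$. Classical-style big-step semantics. Let $X$ be a relation between pairs (statement, classical-style resumption) and classical-style resumptions, written $(s,r)\mathbin X r'$. The convergent evaluation $(s,\sigma)\mathbin{{\Rightarrow}{\downarrow}(X)}r$ ($r:\mathit{res}_{\mathrm c}$), abbreviated $(s,\sigma)\Downarrow_X r$, is defined inductively: $(x:=e,\sigma)\Downarrow_X\mathit{ret}_{\mathrm c}(\sigma[x\mapsto\llbracket e\rrbracket\sigma])$; $(\mathsf{skip},\sigma)\Downarrow_X\mathit{ret}_{\mathrm c}~\sigma$; $(s_0;s_1,\sigma)\Downarrow_X r$ if $(s_0,\sigma)\Downarrow_X\mathit{ret}_{\mathrm c}~\sigma'$ and $(s_1,\sigma')\Downarrow_X r$; $(s_0;s_1,\sigma)\Downarrow_X\mathit{in}_{\mathrm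 c}~f'$ if $(s_0,\sigma)\Downarrow_X\mathit{in}_{\mathrm c}~f$ and $\forall v.\,(s_1,f\,v)\mathbin X f'\,v$; $(s_0;s_1,\sigma)\Downarrow_X\mathit{out}_{\mathrm c}~v~r'$ if $(s_0,\sigma)\Downarrow_X\mathit{out}_{\mathrm c}~v~r$ and $(s_1,r)\mathbin X r'$; $(\mathsf{if}~e~\mathsf{then}~s_t~\mathsf{else}~s_f,\sigma)\Downarrow_X r$ if $\sigma\models e$ and $(s_t,\sigma)\Downarrow_X r$, or $\sigma\not\models e$ and $(s_f,\sigma)\Downarrow_X r$; with $w=\mathsf{while}~e~\mathsf{do}~s_t$: $(w,\sigma)\Downarrow_X r$ if $\sigma\models e$, $(s_t,\sigma)\Downarrow_X\mathit{ret}_{\mathrm c}~\sigma'$ and $(w,\sigma')\Downarrow_X r$; $(w,\sigma)\Downarrow_X\mathit{in}_{\mathrm c}~f'$ if $\sigma\models e$, $(s_t,\sigma)\Downarrow_X\mathit{in}_{\mathrm c}~f$ and $\forall v.\,(w,f\,v)\mathbin X f'\,v$; $(w,\sigma)\Downarrow_X\mathit{out}_{\mathrm c}~v~r'$ if $\sigma\models e$, $(s_t,\sigma)\Downarrow_X\mathit{out}_{\mathrm c}~v~r$ and $(w,r)\mathbin X r'$; $(w,\sigma)\Downarrow_X\mathit{ret}_{\mathrm c}~\sigma$ if $\sigma\not\models e$; $(\mathsf{input}~x,\sigma)\Downarrow_X\mathit{in}_{\mathrm c}(\lambda v.\,\mathit{ret}_{\mathrm c}~\sigma[x\mapsto v])$;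 $(\mathsf{output}~e,\sigma)\Downarrow_X\mathit{out}_{\mathrm c}~(\llbracket e\rrbracket\sigma)~(\mathit{ret}_{\mathrm c}~\sigma)$. The divergent evaluation $(s,\sigma)~{\Rightarrow}{\uparrow}(X)$, abbreviated $(s,\sigma)\Uparrow_X$, is defined coinductively: $(s_0;s_1,\sigma)\Uparrow_X$ if $(s_0,\sigma)\Uparrow_X$, or if $(s_0,\sigma)\Downarrow_X\mathit{ret}_{\mathrm c}~\sigma'$ and $(s_1,\sigma')\Uparrow_X$; $(\mathsf{if}~e~\mathsf{then}~s_t~\mathsf{else}~s_f,\sigma)\Uparrow_X$ if $\sigma\models e$ and $(s_t,\sigma)\Uparrow_X$, or $\sigma\not\models e$ and $(s_f,\sigma)\Uparrow_X$; $(\mathsf{while}~e~\mathsf{do}~s_t,\sigma)\Uparrow_X$ if $\sigma\models e$ and $(s_t,\sigma)\Uparrow_X$, or if $\sigma\models e$, $(s_t,\sigma)\Downarrow_X\mathit{ret}_{\mathrm c}~\sigma'$ and $(\mathsf{while}~e~\mathsf{do}~s_t,\sigma')\Uparrow_X$. Extended evaluation $(s,r)\stackrel{*}{\Rightarrow}r'$ on $\mathit{res}_{\mathrm c}$ is the coinductively defined (greatest) relation with rules: $(s,\mathit{ret}_{\mathrm c}~\sigma)\stackrel{*}{\Rightarrow}r$ if there is $X\subseteq{\stackrel{*}{\Rightarrow}}$ with $(s,\sigma)\Downarrow_X r$; $(s,\mathit{ret}_{\mathrm c}~\sigma)\stackrel{*}{\Rightarrow}\bullet$ if there is $X\subseteq{\stackrel{*}{\Rightarrow}}$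 with $(s,\sigma)\Uparrow_X$; $(s,\mathit{in}_{\mathrm c}~f)\stackrel{*}{\Rightarrow}\mathit{in}_{\mathrm c}~f'$ if $\forall v.\,(s,f\,v)\stackrel{*}{\Rightarrow}f'\,v$; $(s,\mathit{out}_{\mathrm c}~v~r)\stackrel{*}{\Rightarrow}\mathit{out}_{\mathrm c}~v~r'$ if $(s,r)\stackrel{*}{\Rightarrow}r'$; $(s,\bullet)\stackrel{*}{\Rightarrow}\bullet$. Finally, $(s,\sigma)\Rightarrow_{\mathrm c}r$ if $(s,\sigma)\mathbin{{\Rightarrow}{\downarrow}({\stackrel{*}{\Rightarrow}})}r$, and $(s,\sigma)\Rightarrow_{\mathrm c}\bullet$ if $(s,\sigma)~{\Rightarrow}{\uparrow}({\stackrel{*}{\Rightarrow}})$ (these are the only two rules). -}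

module Defs where

open import Data.Integer.Base using (ℤ; 0ℤ)
open import Data.List.Base using (List; []; _∷_)
open import Data.Product.Base using (_×_; _,_)
open import Data.Unit.Base using (⊤; tt)
open import Level using (Level; 0ℓ; _⊔_) renaming (suc to lsuc)
open import Relation.Binary.Definitions using (DecidableEquality)
open import Relation.Binary.PropositionalEquality using (_≡_; _≢_)
open import Relation.Nullary using (¬_; yes; no)
open import Relation.Unary using (Pred; _∈_; _⊆_)

1ℓ : Level
1ℓ = lsuc 0ℓ

-- The relation coinductively defined by the rules F, i.e. the union of all
-- post-fixed points of F.  F is monotone in every use below.  The post-fixed
-- points are taken in Set; excluded middle, which the theorem assumes for Set₁,
-- reflects Set₁-valued ones into Set, so none are lost.
record ν {A : Set} {ℓ} (F : Pred A 0ℓ → Pred A ℓ) (a : A) : Set (1ℓ ⊔ ℓ) where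
  constructor coind
  field
    R    : Pred A 0ℓ
    R⊆FR : R ⊆ F R
    R∋a  : a ∈ R

record Language : Set₁ where
  field
    Var  : Set
    _≟_  : DecidableEquality Var
    Expr : Set
    ⟦_⟧  : Expr → (Var → ℤ) → ℤ

module Semantics (L : Language) where
  open Language L public

  State : Set
  State = Var → ℤ

  _[_↦_] : State → Var → ℤ → State
  (σ [ x ↦ v ]) y with y ≟ x
  ... | yes _ = v
  ... | no  _ = σ y

  infix 4 _⊨_ _⊭_

  _⊨_ : State → Expr → Set
  σ ⊨ e = ⟦ e ⟧ σ ≢ 0ℤ

  _⊭_ : State → Expr → Set
  σ ⊭ e = ¬ (σ ⊨ e)

  infixr 5 _⨾_
  infix  6 _≔_

  data Stmt : Set where
    skip   : Stmt
    _⨾_    : Stmt → Stmt → Stmt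
    _≔_    : Var → Expr → Stmt
    ifte   : Expr → Stmt → Stmt → Stmt
    while  : Expr → Stmt → Stmt
    input  : Var → Stmt
    output : Expr → Stmt

  ----------------------------------------------------------------------
  -- Delayful resumptions

  data ResF (A : Set) : Set where
    ret : State → ResF A
    inp : (ℤ → A) → ResF A
    out : ℤ → A → ResF A
    δ   : A → ResF A

  -- The final coalgebra of ResF, as a setoid under strong bisimilarity.  A
  -- possibly infinite tree is the function taking a path from the root to the
  -- constructor found there.  The integer in a path selects the subtree of an
  -- inp; an out or a δ has one subtree, read along 0 (the other directions,
  -- and all those below a ret, are never looked at).
  record ∞Res : Set where
    constructor tree
    field at : List ℤ → ResF ⊤
  open ∞Res public

  Res : Set
  Res = ResF ∞Res

  subtree : ∞Res → ℤ → ∞Res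
  subtree t v .at p = t .at (v ∷ p)

  force : ∞Res → Res
  force t with t .at []
  ... | ret σ   = ret σ
  ... | inp _   = inp (subtree t)
  ... | out v _ = out v (subtree t 0ℤ)
  ... | δ _     = δ (subtree t 0ℤ)

  delay : Res → ∞Res
  delay (ret σ)   .at _       = ret σ
  delay (inp f)   .at []      = inp (λ _ → tt)
  delay (inp f)   .at (v ∷ p) = f v .at p
  delay (out v r) .at []      = out v tt
  delay (out v r) .at (_ ∷ p) = r .at p
  delay (δ r)     .at []      = δ tt
  delay (δ r)     .at (_ ∷ p) = r .at p

  mapF : ∀ {A B : Set} → (A → B) → ResF A → ResF B
  mapF g (ret σ)   = ret σ
  mapF g (inp f)   = inp (λ v → g (f v))
  mapF g (out v a) = out v (g a)
  mapF g (δ a)     = δ (g a)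

  -- Corecursion: force (∞unfold c a) is mapF (∞unfold c) (c a).
  module _ {A : Set} (c : A → ResF A) where

    unfoldAt : ResF A → List ℤ → ResF ⊤
    unfoldAt (ret σ)   _       = ret σ
    unfoldAt (inp f)   []      = inp (λ _ → tt)
    unfoldAt (inp f)   (v ∷ p) = unfoldAt (c (f v)) p
    unfoldAt (out v a) []      = out v tt
    unfoldAt (out v a) (_ ∷ p) = unfoldAt (c a) p
    unfoldAt (δ a)     []      = δ tt
    unfoldAt (δ a)     (_ ∷ p) = unfoldAt (c a) p

    ∞unfold : A → ∞Res
    ∞unfold a .at = unfoldAt (c a)

    unfold : A → Res
    unfold a = mapF ∞unfold (c a)

  data Bisim {ℓ} (R : Pred (Res × Res) ℓ) : Pred (Res × Res) ℓ where
    ret : ∀ {σ} → Bisim R (ret σ , ret σ)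
    inp : ∀ {f f*} → (∀ v → R (force (f v) , force (f* v))) →
          Bisim R (inp f , inp f*)
    out : ∀ {v r r*} → R (force r , force r*) →
          Bisim R (out v r , out v r*)
    δ   : ∀ {r r*} → R (force r , force r*) →
          Bisim R (δ r , δ r*)

  infix 4 _≈_ _↓_ _≅_

  _≈_ : Res → Res → Set₁
  r ≈ r* = ν Bisim (r , r*)

  data _↓_ : Res → Res → Set₁ where
    ret : ∀ {σ} → ret σ ↓ ret σ
    inp : ∀ {f f*} → (∀ v → force (f v) ≈ force (f* v)) → inp f ↓ inp f*
    out : ∀ {v r r*} → force r ≈ force r* → out v r ↓ out v r*
    δ   : ∀ {r r'} → force r ↓ r' → δ r ↓ r'

  data WeakBisim {ℓ} (R : Pred (Res × Res) ℓ) : Pred (Res × Res) (1ℓ ⊔ ℓ) where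
    ret : ∀ {r r* σ} → r ↓ ret σ → r* ↓ ret σ → WeakBisim R (r , r*)
    inp : ∀ {r r* f f*} → r ↓ inp f → r* ↓ inp f* →
          (∀ v → R (force (f v) , force (f* v))) →
          WeakBisim R (r , r*)
    out : ∀ {r r* v r' r*'} → r ↓ out v r' → r* ↓ out v r*' →
          R (force r' , force r*') →
          WeakBisim R (r , r*)
    δ   : ∀ {r r*} → R (force r , force r*) → WeakBisim R (δ r , δ r*)

  _≅_ : Res → Res → Set₁
  r ≅ r* = ν WeakBisim (r , r*)

  ----------------------------------------------------------------------
  -- Delayful big-step semantics

  data Judgement : Set where
    eval : Stmt → State → Res → Judgement
    ext  : Stmt → Res → Res → Judgement

  -- Relations on resumptions respect ≈, so a rule whose conclusion mentions a
  -- specific tree concludes about every r bisimilar to it.  The remaining rules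
  -- need no such closure, the relation in their premises being closed already.
  data Eval {ℓ} (R : Pred Judgement ℓ) : Pred Judgement (1ℓ ⊔ ℓ) where
    assign  : ∀ {x e σ r} → r ≈ δ (delay (ret (σ [ x ↦ ⟦ e ⟧ σ ]))) →
              Eval R (eval (x ≔ e) σ r)
    skip    : ∀ {σ} → Eval R (eval skip σ (ret σ))
    seq     : ∀ {s₀ s₁ σ r r'} → R (eval s₀ σ r) → R (ext s₁ r r') →
              Eval R (eval (s₀ ⨾ s₁) σ r')
    if-tt   : ∀ {e sₜ sf σ r} → σ ⊨ e → R (ext sₜ (δ (delay (ret σ))) r) →
              Eval R (eval (ifte e sₜ sf) σ r)
    if-ff   : ∀ {e sₜ sf σ r} → σ ⊭ e → R (ext sf (δ (delay (ret σ))) r) →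
              Eval R (eval (ifte e sₜ sf) σ r)
    while-tt : ∀ {e sₜ σ r r'} → σ ⊨ e →
              R (ext sₜ (δ (delay (ret σ))) r) → R (ext (while e sₜ) r r') →
              Eval R (eval (while e sₜ) σ r')
    while-ff : ∀ {e sₜ σ r} → σ ⊭ e → r ≈ δ (delay (ret σ)) →
              Eval R (eval (while e sₜ) σ r)
    input   : ∀ {x σ r} → r ≈ inp (λ v → delay (ret (σ [ x ↦ v ]))) →
              Eval R (eval (input x) σ r)
    output  : ∀ {e σ r} → r ≈ out (⟦ e ⟧ σ) (delay (ret σ)) →
              Eval R (eval (output e) σ r)
    ret     : ∀ {s σ r} → R (eval s σ r) → Eval R (ext s (ret σ) r)
    inp     : ∀ {s f f'} → (∀ v → R (ext s (force (f v)) (force (f' v)))) →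
              Eval R (ext s (inp f) (inp f'))
    out     : ∀ {s v r r'} → R (ext s (force r) (force r')) →
              Eval R (ext s (out v r) (out v r'))
    δ       : ∀ {s r r'} → R (ext s (force r) (force r')) →
              Eval R (ext s (δ r) (δ r'))

  infix 4 ⟨_,_⟩⇒_ ⟨_,_⟩⇒ᵉˣᵗ_

  ⟨_,_⟩⇒_ : Stmt → State → Res → Set₁
  ⟨ s , σ ⟩⇒ r = ν Eval (eval s σ r)

  ⟨_,_⟩⇒ᵉˣᵗ_ : Stmt → Res → Res → Set₁
  ⟨ s , r ⟩⇒ᵉˣᵗ r' = ν Eval (ext s r r')

  ----------------------------------------------------------------------
  -- Classical-style resumptions, represented in the same way

  data ResᶜF (A : Set) : Set where
    ret : State → ResᶜF A
    inp : (ℤ → A) → ResᶜF A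
    out : ℤ → A → ResᶜF A
    •   : ResᶜF A

  record ∞Resᶜ : Set where
    constructor tree
    field at : List ℤ → ResᶜF ⊤
  open ∞Resᶜ public

  Resᶜ : Set
  Resᶜ = ResᶜF ∞Resᶜ

  subtreeᶜ : ∞Resᶜ → ℤ → ∞Resᶜ
  subtreeᶜ t v .at p = t .at (v ∷ p)

  forceᶜ : ∞Resᶜ → Resᶜ
  forceᶜ t with t .at []
  ... | ret σ   = ret σ
  ... | inp _   = inp (subtreeᶜ t)
  ... | out v _ = out v (subtreeᶜ t 0ℤ)
  ... | •       = •

  delayᶜ : Resᶜ → ∞Resᶜ
  delayᶜ (ret σ)   .at _       = ret σ
  delayᶜ (inp f)   .at []      = inp (λ _ → tt)
  delayᶜ (inp f)   .at (v ∷ p) = f v .at p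
  delayᶜ (out v r) .at []      = out v tt
  delayᶜ (out v r) .at (_ ∷ p) = r .at p
  delayᶜ •         .at _       = •

  data Bisimᶜ {ℓ} (R : Pred (Resᶜ × Resᶜ) ℓ) : Pred (Resᶜ × Resᶜ) ℓ where
    ret : ∀ {σ} → Bisimᶜ R (ret σ , ret σ)
    inp : ∀ {f f*} → (∀ v → R (forceᶜ (f v) , forceᶜ (f* v))) →
          Bisimᶜ R (inp f , inp f*)
    out : ∀ {v r r*} → R (forceᶜ r , forceᶜ r*) →
          Bisimᶜ R (out v r , out v r*)
    •   : Bisimᶜ R (• , •)

  infix 4 _≈ᶜ_

  _≈ᶜ_ : Resᶜ → Resᶜ → Set₁
  r ≈ᶜ r* = ν Bisimᶜ (r , r*)

  -- One layer of the embedding; corecursion on it yields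
  -- emb • = δ (emb •) and the homomorphic equations.
  embStep : Resᶜ → ResF Resᶜ
  embStep (ret σ)   = ret σ
  embStep (inp f)   = inp (λ v → forceᶜ (f v))
  embStep (out v r) = out v (forceᶜ r)
  embStep •         = δ •

  emb : Resᶜ → Res
  emb = unfold embStep

  ----------------------------------------------------------------------
  -- Classical-style big-step semantics

  Relᶜ : ∀ ℓ → Set (lsuc ℓ)
  Relᶜ ℓ = Pred ((Stmt × Resᶜ) × Resᶜ) ℓ

  Respects≈ᶜ : ∀ {ℓ} → Relᶜ ℓ → Set (1ℓ ⊔ ℓ)
  Respects≈ᶜ X = ∀ {s r₁ r₂ r₁' r₂'} → r₁ ≈ᶜ r₂ → r₁' ≈ᶜ r₂' →
                 X ((s , r₁) , r₁') → X ((s , r₂) , r₂')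

  infix 4 _⊢⟨_,_⟩⇓_ _⊢⟨_,_⟩⇑

  data _⊢⟨_,_⟩⇓_ {ℓ} (X : Relᶜ ℓ) : Stmt → State → Resᶜ → Set (1ℓ ⊔ ℓ) where
    assign   : ∀ {x e σ} → X ⊢⟨ x ≔ e , σ ⟩⇓ ret (σ [ x ↦ ⟦ e ⟧ σ ])
    skip     : ∀ {σ} → X ⊢⟨ skip , σ ⟩⇓ ret σ
    seq-ret  : ∀ {s₀ s₁ σ σ' r} →
               X ⊢⟨ s₀ , σ ⟩⇓ ret σ' → X ⊢⟨ s₁ , σ' ⟩⇓ r →
               X ⊢⟨ s₀ ⨾ s₁ , σ ⟩⇓ r
    seq-inp  : ∀ {s₀ s₁ σ f f'} →
               X ⊢⟨ s₀ , σ ⟩⇓ inp f →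
               (∀ v → X ((s₁ , forceᶜ (f v)) , forceᶜ (f' v))) →
               X ⊢⟨ s₀ ⨾ s₁ , σ ⟩⇓ inp f'
    seq-out  : ∀ {s₀ s₁ σ v r r'} →
               X ⊢⟨ s₀ , σ ⟩⇓ out v r →
               X ((s₁ , forceᶜ r) , forceᶜ r') →
               X ⊢⟨ s₀ ⨾ s₁ , σ ⟩⇓ out v r'
    if-tt    : ∀ {e sₜ sf σ r} → σ ⊨ e → X ⊢⟨ sₜ , σ ⟩⇓ r →
               X ⊢⟨ ifte e sₜ sf , σ ⟩⇓ r
    if-ff    : ∀ {e sₜ sf σ r} → σ ⊭ e → X ⊢⟨ sf , σ ⟩⇓ r →
               X ⊢⟨ ifte e sₜ sf , σ ⟩⇓ r
    while-ret : ∀ {e sₜ σ σ' r} → σ ⊨ e →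
               X ⊢⟨ sₜ , σ ⟩⇓ ret σ' → X ⊢⟨ while e sₜ , σ' ⟩⇓ r →
               X ⊢⟨ while e sₜ , σ ⟩⇓ r
    while-inp : ∀ {e sₜ σ f f'} → σ ⊨ e →
               X ⊢⟨ sₜ , σ ⟩⇓ inp f →
               (∀ v → X ((while e sₜ , forceᶜ (f v)) , forceᶜ (f' v))) →
               X ⊢⟨ while e sₜ , σ ⟩⇓ inp f'
    while-out : ∀ {e sₜ σ v r r'} → σ ⊨ e →
               X ⊢⟨ sₜ , σ ⟩⇓ out v r →
               X ((while e sₜ , forceᶜ r) , forceᶜ r') →
               X ⊢⟨ while e sₜ , σ ⟩⇓ out v r'
    while-ff : ∀ {e sₜ σ} → σ ⊭ e → X ⊢⟨ while e sₜ , σ ⟩⇓ ret σ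
    input    : ∀ {x σ r} → r ≈ᶜ inp (λ v → delayᶜ (ret (σ [ x ↦ v ]))) →
               X ⊢⟨ input x , σ ⟩⇓ r
    output   : ∀ {e σ r} → r ≈ᶜ out (⟦ e ⟧ σ) (delayᶜ (ret σ)) →
               X ⊢⟨ output e , σ ⟩⇓ r

  data Diverge {ℓ ℓ'} (X : Relᶜ ℓ) (R : Pred (Stmt × State) ℓ') :
               Pred (Stmt × State) (1ℓ ⊔ ℓ ⊔ ℓ') where
    seq₀   : ∀ {s₀ s₁ σ} → R (s₀ , σ) → Diverge X R (s₀ ⨾ s₁ , σ)
    seq₁   : ∀ {s₀ s₁ σ σ'} → X ⊢⟨ s₀ , σ ⟩⇓ ret σ' → R (s₁ , σ') →
             Diverge X R (s₀ ⨾ s₁ , σ)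
    if-tt  : ∀ {e sₜ sf σ} → σ ⊨ e → R (sₜ , σ) →
             Diverge X R (ifte e sₜ sf , σ)
    if-ff  : ∀ {e sₜ sf σ} → σ ⊭ e → R (sf , σ) →
             Diverge X R (ifte e sₜ sf , σ)
    while₀ : ∀ {e sₜ σ} → σ ⊨ e → R (sₜ , σ) →
             Diverge X R (while e sₜ , σ)
    while₁ : ∀ {e sₜ σ σ'} → σ ⊨ e →
             X ⊢⟨ sₜ , σ ⟩⇓ ret σ' → R (while e sₜ , σ') →
             Diverge X R (while e sₜ , σ)

  _⊢⟨_,_⟩⇑ : ∀ {ℓ} → Relᶜ ℓ → Stmt → State → Set (1ℓ ⊔ ℓ)
  X ⊢⟨ s , σ ⟩⇑ = ν (Diverge X) (s , σ)

  data Extᶜ {ℓ} (R : Relᶜ ℓ) : Relᶜ (1ℓ ⊔ ℓ) where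
    ret⇓ : ∀ {s σ r} (X : Relᶜ 0ℓ) → Respects≈ᶜ X → X ⊆ R →
           X ⊢⟨ s , σ ⟩⇓ r → Extᶜ R ((s , ret σ) , r)
    ret⇑ : ∀ {s σ} (X : Relᶜ 0ℓ) → Respects≈ᶜ X → X ⊆ R →
           X ⊢⟨ s , σ ⟩⇑ → Extᶜ R ((s , ret σ) , •)
    inp  : ∀ {s f f'} → (∀ v → R ((s , forceᶜ (f v)) , forceᶜ (f' v))) →
           Extᶜ R ((s , inp f) , inp f')
    out  : ∀ {s v r r'} → R ((s , forceᶜ r) , forceᶜ r') →
           Extᶜ R ((s , out v r) , out v r')
    •    : ∀ {s} → Extᶜ R ((s , •) , •)

  ⇒* : Relᶜ 1ℓ
  ⇒* = ν Extᶜ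

  infix 4 ⟨_,_⟩⇒ᶜ_

  data ⟨_,_⟩⇒ᶜ_ : Stmt → State → Resᶜ → Set₁ where
    conv : ∀ {s σ r} → ⇒* ⊢⟨ s , σ ⟩⇓ r → ⟨ s , σ ⟩⇒ᶜ r
    div  : ∀ {s σ} → ⇒* ⊢⟨ s , σ ⟩⇑ → ⟨ s , σ ⟩⇒ᶜ •

{-# OPTIONS --safe #-}
-- Excluded middle decides, for each delayful resumption, whether finitely many δ
-- lead to an observable constructor; replacing silent divergence by • corecursively
-- gives norm r ≅ r.  The relation holding between (s , norm q) and norm q' whenever
-- (s , q) ⇒ᵉˣᵗ q' is a post-fixed point of the rules of ⇒*.  For this, a delayful
-- evaluation reaching an observable constructor yields a convergent one by
-- lexicographic induction on the number of delays and the statement (each iteration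
-- of a loop consumes a delay), and one reaching none yields a divergent one by
-- coinduction.
module Submission where

open import Axiom.ExcludedMiddle using (ExcludedMiddle)
open import Data.Empty using (⊥-elim)
open import Data.Integer.Base using (ℤ)
open import Data.List.Base using (List; []; _∷_)
open import Data.Nat.Base using (ℕ; suc; _+_; _≤_; z≤n; s≤s)
open import Data.Nat.Properties using (≤-trans; ≤-refl; m≤n+m; n≤1+n)
open import Data.Product.Base using (_×_; _,_; ∃-syntax; -,_)
open import Data.Unit.Base using (⊤; tt)
open import Defs
open import Level using (0ℓ; Lift; lift; lower)
open import Relation.Binary.PropositionalEquality using (_≡_; refl; sym; trans; cong)
open import Relation.Nullary using (¬_; Dec; yes; no)
open import Relation.Nullary.Decidable using (True; toWitness; fromWitness; map′)
open import Relation.Unary using (Pred; _⊆_)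

module _ (L : Language) where
  open Semantics L

  -- Strong bisimilarity.

  ≈-refl : ∀ {r} → r ≈ r
  ≈-refl = coind (λ (r , r*) → r ≡ r*) step refl
    where
    step : (λ (r , r*) → r ≡ r*) ⊆ Bisim (λ (r , r*) → r ≡ r*)
    step {ret σ , _}   refl = ret
    step {inp f , _}   refl = inp (λ _ → refl)
    step {out v r , _} refl = out refl
    step {δ r , _}     refl = δ refl

  ≈ret⇒≡ : ∀ {r σ} → r ≈ ret σ → r ≡ ret σ
  ≈ret⇒≡ (coind R R⊆ Rr) with ret ← R⊆ Rr = refl

  ≡⊆Bisimᶜ : (λ (r , r*) → r ≡ r*) ⊆ Bisimᶜ (λ (r , r*) → r ≡ r*)
  ≡⊆Bisimᶜ {ret σ , _}   refl = ret
  ≡⊆Bisimᶜ {inp f , _}   refl = inp (λ _ → refl)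
  ≡⊆Bisimᶜ {out v r , _} refl = out refl
  ≡⊆Bisimᶜ {• , _}       refl = •

  ≈ᶜ-refl : ∀ {r} → r ≈ᶜ r
  ≈ᶜ-refl = coind (λ (r , r*) → r ≡ r*) ≡⊆Bisimᶜ refl

  -- Pointwise equal children do not make two `inp` nodes equal without function extensionality, but
  -- they do make them bisimilar: one layer of `Bisimᶜ` over equality is a post-fixed point because
  -- equality is one.
  Bisimᶜ-≡⇒≈ᶜ : ∀ {r r*} → Bisimᶜ (λ (r , r*) → r ≡ r*) (r , r*) → r ≈ᶜ r*
  Bisimᶜ-≡⇒≈ᶜ b = coind (Bisimᶜ (λ (r , r*) → r ≡ r*)) step b
    where
    step : Bisimᶜ (λ (r , r*) → r ≡ r*) ⊆ Bisimᶜ (Bisimᶜ (λ (r , r*) → r ≡ r*))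
    step ret     = ret
    step (inp g) = inp (λ v → ≡⊆Bisimᶜ (g v))
    step (out g) = out (≡⊆Bisimᶜ g)
    step •       = •

  ≈ᶜ-reflexive : ∀ {r r*} → r ≡ r* → r ≈ᶜ r*
  ≈ᶜ-reflexive refl = ≈ᶜ-refl

  ≈ᶜ-sym : ∀ {r r*} → r ≈ᶜ r* → r* ≈ᶜ r
  ≈ᶜ-sym (coind R R⊆ Rr) = coind (λ (r* , r) → R (r , r*)) step Rr
    where
    step : (λ (r* , r) → R (r , r*)) ⊆ Bisimᶜ (λ (r* , r) → R (r , r*))
    step Rr with R⊆ Rr
    ... | ret   = ret
    ... | inp g = inp g
    ... | out g = out g
    ... | •     = •

  ≈ᶜ-trans : ∀ {r₁ r₂ r₃} → r₁ ≈ᶜ r₂ → r₂ ≈ᶜ r₃ → r₁ ≈ᶜ r₃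
  ≈ᶜ-trans (coind R R⊆ Rr) (coind S S⊆ Sr) = coind T step (-, Rr , Sr)
    where
    T : Pred (Resᶜ × Resᶜ) 0ℓ
    T (r₁ , r₃) = ∃[ r₂ ] (R (r₁ , r₂) × S (r₂ , r₃))
    step : T ⊆ Bisimᶜ T
    step (_ , Rr , Sr) with R⊆ Rr | S⊆ Sr
    ... | ret   | ret    = ret
    ... | inp g | inp g' = inp (λ v → -, g v , g' v)
    ... | out g | out g' = out (-, g , g')
    ... | •     | •      = •

  -- Invariance and monotonicity of classical-style evaluation.

  ⇓-resp-≈ᶜ : ∀ {X : Relᶜ 0ℓ} {s σ r r*} → Respects≈ᶜ X → r ≈ᶜ r* →
              X ⊢⟨ s , σ ⟩⇓ r → X ⊢⟨ s , σ ⟩⇓ r*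
  ⇓-resp-≈ᶜ Xr (coind R R⊆ Rr) assign with ret ← R⊆ Rr = assign
  ⇓-resp-≈ᶜ Xr (coind R R⊆ Rr) skip with ret ← R⊆ Rr = skip
  ⇓-resp-≈ᶜ Xr eq (seq-ret d d') = seq-ret d (⇓-resp-≈ᶜ Xr eq d')
  -- The rule constrains the children of the result only through `X`, whose closure under `≈ᶜ`
  -- absorbs the change.
  ⇓-resp-≈ᶜ Xr (coind R R⊆ Rr) (seq-inp d x) with inp g ← R⊆ Rr =
    seq-inp d (λ v → Xr ≈ᶜ-refl (coind R R⊆ (g v)) (x v))
  ⇓-resp-≈ᶜ Xr (coind R R⊆ Rr) (seq-out d x) with out g ← R⊆ Rr =
    seq-out d (Xr ≈ᶜ-refl (coind R R⊆ g) x)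
  ⇓-resp-≈ᶜ Xr eq (if-tt p d) = if-tt p (⇓-resp-≈ᶜ Xr eq d)
  ⇓-resp-≈ᶜ Xr eq (if-ff p d) = if-ff p (⇓-resp-≈ᶜ Xr eq d)
  ⇓-resp-≈ᶜ Xr eq (while-ret p d d') = while-ret p d (⇓-resp-≈ᶜ Xr eq d')
  ⇓-resp-≈ᶜ Xr (coind R R⊆ Rr) (while-inp p d x) with inp g ← R⊆ Rr =
    while-inp p d (λ v → Xr ≈ᶜ-refl (coind R R⊆ (g v)) (x v))
  ⇓-resp-≈ᶜ Xr (coind R R⊆ Rr) (while-out p d x) with out g ← R⊆ Rr =
    while-out p d (Xr ≈ᶜ-refl (coind R R⊆ g) x)
  ⇓-resp-≈ᶜ Xr (coind R R⊆ Rr) (while-ff p) with ret ← R⊆ Rr = while-ff p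
  ⇓-resp-≈ᶜ Xr eq (input eq') = input (≈ᶜ-trans (≈ᶜ-sym eq) eq')
  ⇓-resp-≈ᶜ Xr eq (output eq') = output (≈ᶜ-trans (≈ᶜ-sym eq) eq')

  ⇓-mono : ∀ {ℓ ℓ'} {X : Relᶜ ℓ} {Y : Relᶜ ℓ'} → X ⊆ Y → ∀ {s σ r} →
           X ⊢⟨ s , σ ⟩⇓ r → Y ⊢⟨ s , σ ⟩⇓ r
  ⇓-mono X⊆Y assign             = assign
  ⇓-mono X⊆Y skip               = skip
  ⇓-mono X⊆Y (seq-ret d d')     = seq-ret (⇓-mono X⊆Y d) (⇓-mono X⊆Y d')
  ⇓-mono X⊆Y (seq-inp d x)      = seq-inp (⇓-mono X⊆Y d) (λ v → X⊆Y (x v))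
  ⇓-mono X⊆Y (seq-out d x)      = seq-out (⇓-mono X⊆Y d) (X⊆Y x)
  ⇓-mono X⊆Y (if-tt p d)        = if-tt p (⇓-mono X⊆Y d)
  ⇓-mono X⊆Y (if-ff p d)        = if-ff p (⇓-mono X⊆Y d)
  ⇓-mono X⊆Y (while-ret p d d') = while-ret p (⇓-mono X⊆Y d) (⇓-mono X⊆Y d')
  ⇓-mono X⊆Y (while-inp p d x)  = while-inp p (⇓-mono X⊆Y d) (λ v → X⊆Y (x v))
  ⇓-mono X⊆Y (while-out p d x)  = while-out p (⇓-mono X⊆Y d) (X⊆Y x)
  ⇓-mono X⊆Y (while-ff p)       = while-ff p
  ⇓-mono X⊆Y (input eq)         = input eq
  ⇓-mono X⊆Y (output eq)        = output eq

  ⇑-mono : ∀ {ℓ ℓ'} {X : Relᶜ ℓ} {Y : Relᶜ ℓ'} → X ⊆ Y → ∀ {s σ} →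
           X ⊢⟨ s , σ ⟩⇑ → Y ⊢⟨ s , σ ⟩⇑
  ⇑-mono {X = X} {Y} X⊆Y (coind R R⊆ Rr) = coind R (λ x → diverge (R⊆ x)) Rr
    where
    diverge : Diverge X R ⊆ Diverge Y R
    diverge (seq₀ x)       = seq₀ x
    diverge (seq₁ d x)     = seq₁ (⇓-mono X⊆Y d) x
    diverge (if-tt p x)    = if-tt p x
    diverge (if-ff p x)    = if-ff p x
    diverge (while₀ p x)   = while₀ p x
    diverge (while₁ p d x) = while₁ p (⇓-mono X⊆Y d) x

  -- Head normal forms

  -- An observable head constructor is a ResᶜF other than •, which r ↘[ n ] h never
  -- reaches; • is thereby free to stand for the absence of a head normal form.
  Head : Set
  Head = ResᶜF ∞Res

  infix 4 _↘[_]_ _↠[_]_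

  data _↘[_]_ : Res → ℕ → Head → Set where
    ret : ∀ {σ} → ret σ ↘[ 0 ] ret σ
    inp : ∀ {f} → inp f ↘[ 0 ] inp f
    out : ∀ {v r} → out v r ↘[ 0 ] out v r
    δ   : ∀ {r n h} → force r ↘[ n ] h → δ r ↘[ suc n ] h

  data _↠[_]_ : Res → ℕ → Res → Set where
    done : ∀ {r} → r ↠[ 0 ] r
    δ    : ∀ {r n r'} → force r ↠[ n ] r' → δ r ↠[ suc n ] r'

  Converges : Res → Set
  Converges r = ∃[ n ] ∃[ h ] (r ↘[ n ] h)

  ↘-functional : ∀ {r n h n' h'} → r ↘[ n ] h → r ↘[ n' ] h' → h ≡ h'
  ↘-functional ret   ret    = refl
  ↘-functional inp   inp    = refl
  ↘-functional out   out    = refl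
  ↘-functional (δ d) (δ d') = ↘-functional d d'

  ↠-↘ : ∀ {r r' m n h} → r ↠[ m ] r' → r' ↘[ n ] h → r ↘[ m + n ] h
  ↠-↘ done  d = d
  ↠-↘ (δ p) d = δ (↠-↘ p d)

  -- Delays are deterministic, so those of the first path are a prefix of those leading to the head.
  ↠-↘⁻¹ : ∀ {r r' m n h} → r ↠[ m ] r' → r ↘[ n ] h →
          ∃[ k ] (r' ↘[ k ] h × n ≡ m + k)
  ↠-↘⁻¹ done  d     = -, d , refl
  ↠-↘⁻¹ (δ p) (δ d) with k , d' , refl ← ↠-↘⁻¹ p d = k , d' , refl

  -- Corecursion and its computation rules.

  mapFᶜ : ∀ {A B : Set} → (A → B) → ResᶜF A → ResᶜF B
  mapFᶜ g (ret σ)   = ret σ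
  mapFᶜ g (inp f)   = inp (λ v → g (f v))
  mapFᶜ g (out v a) = out v (g a)
  mapFᶜ g •         = •

  module _ {A : Set} (c : A → ResᶜF A) where

    unfoldAtᶜ : ResᶜF A → List ℤ → ResᶜF ⊤
    unfoldAtᶜ (ret σ)   _       = ret σ
    unfoldAtᶜ (inp f)   []      = inp (λ _ → tt)
    unfoldAtᶜ (inp f)   (v ∷ p) = unfoldAtᶜ (c (f v)) p
    unfoldAtᶜ (out v a) []      = out v tt
    unfoldAtᶜ (out v a) (_ ∷ p) = unfoldAtᶜ (c a) p
    unfoldAtᶜ •         _       = •

    ∞unfoldᶜ : A → ∞Resᶜ
    ∞unfoldᶜ a .at = unfoldAtᶜ (c a)

    -- Stated for an arbitrary layer `x` instead of `c a`, so that case analysis on `x` lets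
    -- `forceᶜ` compute.
    forceᶜ-unfoldAtᶜ : ∀ x → forceᶜ (tree (unfoldAtᶜ x)) ≡ mapFᶜ ∞unfoldᶜ x
    forceᶜ-unfoldAtᶜ (ret σ)   = refl
    forceᶜ-unfoldAtᶜ (inp f)   = refl
    forceᶜ-unfoldAtᶜ (out v a) = refl
    forceᶜ-unfoldAtᶜ •         = refl

  force-unfoldAt : ∀ {A : Set} (c : A → ResF A) x →
                   force (tree (unfoldAt c x)) ≡ mapF (∞unfold c) x
  force-unfoldAt c (ret σ)   = refl
  force-unfoldAt c (inp f)   = refl
  force-unfoldAt c (out v a) = refl
  force-unfoldAt c (δ a)     = refl

  ≈ret⇒↘ : ∀ {r σ} → r ≈ ret σ → r ↘[ 0 ] ret σ
  ≈ret⇒↘ eq with refl ← ≈ret⇒≡ eq = ret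

  ≈δret⇒↘ : ∀ {r σ} → r ≈ δ (delay (ret σ)) → r ↘[ 1 ] ret σ
  ≈δret⇒↘ (coind R R⊆ Rr) with δ g ← R⊆ Rr = δ (≈ret⇒↘ (coind R R⊆ g))

  ¬Converges-force : ∀ {t} → ¬ Converges (δ t) → ¬ Converges (force t)
  ¬Converges-force ¬c (_ , _ , d) = ¬c (-, -, δ d)

  -- Normal forms of delayful resumptions.

  module _ (lem : ExcludedMiddle 1ℓ) where

    em : (P : Set) → Dec P
    em P = map′ lower lift (lem {Lift 1ℓ P})

    normHead : Res → Head
    normHead r with em (Converges r)
    ... | yes (_ , h , _) = h
    ... | no _            = •

    ∞norm : ∞Res → ∞Resᶜ
    ∞norm = ∞unfoldᶜ (λ t → normHead (force t))

    observe : Head → Resᶜ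
    observe = mapFᶜ ∞norm

    norm : Res → Resᶜ
    norm r = observe (normHead r)

    forceᶜ-∞norm : ∀ t → forceᶜ (∞norm t) ≡ norm (force t)
    forceᶜ-∞norm t = forceᶜ-unfoldAtᶜ _ (normHead (force t))

    norm-↘ : ∀ {r n h} → r ↘[ n ] h → norm r ≡ observe h
    norm-↘ {r} d with em (Converges r)
    ... | yes (_ , _ , d') = cong observe (↘-functional d' d)
    ... | no ¬c            = ⊥-elim (¬c (-, -, d))

    norm-¬Converges : ∀ {r} → ¬ Converges r → norm r ≡ •
    norm-¬Converges {r} ¬c with em (Converges r)
    ... | yes c = ⊥-elim (¬c c)
    ... | no _  = refl

    norm-↠ : ∀ {r m r'} → r ↠[ m ] r' → norm r ≡ norm r'
    norm-↠ {r' = r'} p with em (Converges r')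
    ... | yes (_ , _ , d) = norm-↘ (↠-↘ p d)
    ... | no ¬c = norm-¬Converges λ (_ , _ , d) →
      let _ , d' , _ = ↠-↘⁻¹ p d in ¬c (-, -, d')

    ↘ret⇒↓ : ∀ {r n σ} → r ↘[ n ] ret σ → r ↓ ret σ
    ↘ret⇒↓ ret   = ret
    ↘ret⇒↓ (δ d) = δ (↘ret⇒↓ d)

    ↘inp⇒↓ : ∀ {r n f} → r ↘[ n ] inp f → r ↓ inp f
    ↘inp⇒↓ inp   = inp (λ _ → ≈-refl)
    ↘inp⇒↓ (δ d) = δ (↘inp⇒↓ d)

    ↘out⇒↓ : ∀ {r n v r'} → r ↘[ n ] out v r' → r ↓ out v r'
    ↘out⇒↓ out   = out ≈-refl
    ↘out⇒↓ (δ d) = δ (↘out⇒↓ d)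

    ¬↘• : ∀ {r n} → ¬ (r ↘[ n ] •)
    ¬↘• (δ d) = ¬↘• d

    -- The graph of `emb` after `norm` is itself a weak bisimulation.
    ≅-emb-norm : ∀ r → r ≅ emb (norm r)
    ≅-emb-norm r = coind W step refl
      where
      W : Pred (Res × Res) 0ℓ
      W (r , r*) = r* ≡ emb (norm r)

      tail : ∀ t → W (force t , force (∞unfold embStep (forceᶜ (∞norm t))))
      tail t = trans (force-unfoldAt embStep _) (cong emb (forceᶜ-∞norm t))

      converge : ∀ {r n} h → r ↘[ n ] h → WeakBisim W (r , emb (observe h))
      converge (ret σ)   d = ret (↘ret⇒↓ d) ret
      converge (inp f)   d = inp (↘inp⇒↓ d) (inp (λ _ → ≈-refl)) (λ v → tail (f v))
      converge (out v t) d = out (↘out⇒↓ d) (out ≈-refl) (tail t)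
      converge •         d = ⊥-elim (¬↘• d)

      diverge : ∀ {r} → ¬ Converges r → WeakBisim W (r , emb •)
      diverge {ret σ}   ¬c = ⊥-elim (¬c (-, -, ret))
      diverge {inp f}   ¬c = ⊥-elim (¬c (-, -, inp))
      diverge {out v t} ¬c = ⊥-elim (¬c (-, -, out))
      -- Both sides spend one δ: `emb •` is a δ over itself, and the tail of a divergent resumption
      -- still diverges.
      diverge {δ t}     ¬c = δ (cong emb (sym (norm-¬Converges (¬Converges-force ¬c))))

      step : W ⊆ WeakBisim W
      step {r , _} refl with em (Converges r)
      ... | yes (_ , h , d) = converge h d
      ... | no ¬c           = diverge ¬c

    ≈ret⇒norm≡ : ∀ t {σ} → force t ≈ ret σ → forceᶜ (∞norm t) ≡ ret σ
    ≈ret⇒norm≡ t eq = trans (forceᶜ-∞norm t) (norm-↘ (≈ret⇒↘ eq))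

    -- Normalising a delayful derivation

    module _ (J : Pred Judgement 0ℓ) (J⊆ : J ⊆ Eval J) where

      -- What remains of the result of an extended evaluation of `s` once the input resumption has
      -- shown its head after `m` delays. An input or output head reappears at the same depth; at a
      -- `ret` head, `s` itself starts there and may delay further.
      data AfterHead (s : Stmt) (m : ℕ) : Head → Res → Set where
        ret : ∀ {σ r r'} → r ↠[ m ] r' → J (eval s σ r') → AfterHead s m (ret σ) r
        inp : ∀ {f f' r} → r ↘[ m ] inp f' →
              (∀ v → J (ext s (force (f v)) (force (f' v)))) →
              AfterHead s m (inp f) r
        out : ∀ {v t t' r} → r ↘[ m ] out v t' →
              J (ext s (force t) (force t')) → AfterHead s m (out v t) r

      ext-↘ : ∀ {s q q' m h} → J (ext s q q') → q ↘[ m ] h → AfterHead s m h q'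
      ext-↘ x ret with ret y ← J⊆ x = ret done y
      ext-↘ x inp with inp y ← J⊆ x = inp inp y
      ext-↘ x out with out y ← J⊆ x = out out y
      ext-↘ x (δ d) with δ y ← J⊆ x with ext-↘ y d
      ... | ret p z  = ret (δ p) z
      ... | inp d' z = inp (δ d') z
      ... | out d' z = out (δ d') z

      -- Every δ of `q` is copied into `q'`, so `q` must show its head no later than `q'`. The bound
      -- makes the induction in `eval⇒⇓` possible.
      ext-↘⁻¹ : ∀ {s q q' n h'} → J (ext s q q') → q' ↘[ n ] h' →
                ∃[ m ] ∃[ h ] (q ↘[ m ] h × m ≤ n)
      ext-↘⁻¹ {q = ret σ}   x d = -, -, ret , z≤n
      ext-↘⁻¹ {q = inp f}   x d = -, -, inp , z≤n
      ext-↘⁻¹ {q = out v t} x d = -, -, out , z≤n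
      ext-↘⁻¹ {q = δ t}     x d with δ y ← J⊆ x with δ d' ← d
        with _ , _ , e , m≤n ← ext-↘⁻¹ y d' = -, -, δ e , s≤s m≤n

      -- Testing a guard costs one δ; peeling it off exposes the evaluation of the chosen branch.
      ext-δret : ∀ {s σ r} → J (ext s (δ (delay (ret σ))) r) →
                 ∃[ t ] (r ≡ δ t × J (eval s σ (force t)))
      ext-δret x with δ y ← J⊆ x with ret z ← J⊆ y = -, refl , z

      -- An input or output head of `q` would be visible in `q'`, so `q` must terminate and the
      -- divergence comes from running `s` afterwards.
      ¬Converges-after : ∀ {s q q' m h} → J (ext s q q') → q ↘[ m ] h → ¬ Converges q' →
        ∃[ σ ] ∃[ r ] (h ≡ ret σ × J (eval s σ r) × ¬ Converges r)
      ¬Converges-after x d ¬c with ext-↘ x d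
      ... | ret p y = -, -, refl , y , λ (_ , _ , d') → ¬c (-, -, ↠-↘ p d')
      ... | inp d' _ = ⊥-elim (¬c (-, -, d'))
      ... | out d' _ = ⊥-elim (¬c (-, -, d'))

      -- ≈ᶜ lives in Set₁, so the relation has to be brought down to Set.
      Norm : Relᶜ 0ℓ
      Norm ((s , x) , x') =
        True (lem {∃[ q ] ∃[ q' ] (J (ext s q q') × norm q ≈ᶜ x × norm q' ≈ᶜ x')})

      Norm-resp : Respects≈ᶜ Norm
      Norm-resp eq eq' x with _ , _ , j , e , e' ← toWitness x =
        fromWitness (-, -, j , ≈ᶜ-trans e eq , ≈ᶜ-trans e' eq')

      ext⇒Norm : ∀ {s t t'} → J (ext s (force t) (force t')) →
                 Norm ((s , forceᶜ (∞norm t)) , forceᶜ (∞norm t'))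
      ext⇒Norm {t = t} {t'} x =
        fromWitness (-, -, x , ≈ᶜ-reflexive (sym (forceᶜ-∞norm t))
                             , ≈ᶜ-reflexive (sym (forceᶜ-∞norm t')))

      -- The pair `(N , s)` decreases lexicographically. `N` only bounds the number of delays,
      -- because the counts of the subevaluations are known only up to inequality.
      eval⇒⇓ : ∀ N s {σ r n h} → n ≤ N → J (eval s σ r) → r ↘[ n ] h →
               Norm ⊢⟨ s , σ ⟩⇓ observe h
      eval⇒⇓ N skip n≤N x d with skip ← J⊆ x with ret ← d = skip
      eval⇒⇓ N (y ≔ e) n≤N x d with assign eq ← J⊆ x
        with refl ← ↘-functional d (≈δret⇒↘ eq) = assign
      eval⇒⇓ N (input y) n≤N x d with input (coind R R⊆ Rr) ← J⊆ x with inp g ← R⊆ Rr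
        with inp ← d = input (Bisimᶜ-≡⇒≈ᶜ (inp λ v → ≈ret⇒norm≡ _ (coind R R⊆ (g v))))
      eval⇒⇓ N (output e) n≤N x d with output (coind R R⊆ Rr) ← J⊆ x with out g ← R⊆ Rr
        with out ← d = output (Bisimᶜ-≡⇒≈ᶜ (out (≈ret⇒norm≡ _ (coind R R⊆ g))))
      eval⇒⇓ N (s₀ ⨾ s₁) n≤N x d with seq y z ← J⊆ x
        with _ , _ , d₀ , m≤n ← ext-↘⁻¹ z d with eval⇒⇓ N s₀ (≤-trans m≤n n≤N) y d₀ | ext-↘ z d₀
      -- The delays of `s₀` are a prefix of those of the whole, so the rest still fits the bound.
      ... | ih | ret p w with _ , d₁ , refl ← ↠-↘⁻¹ p d =
        seq-ret ih (eval⇒⇓ N s₁ (≤-trans (m≤n+m _ _) n≤N) w d₁)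
      ... | ih | inp d' w with refl ← ↘-functional d d' = seq-inp ih (λ v → ext⇒Norm (w v))
      ... | ih | out d' w with refl ← ↘-functional d d' = seq-out ih (ext⇒Norm w)
      eval⇒⇓ N (ifte e sₜ sf) n≤N x d with J⊆ x
      ... | if-tt p y with _ , refl , z ← ext-δret y with δ d' ← d =
        if-tt p (eval⇒⇓ N sₜ (≤-trans (n≤1+n _) n≤N) z d')
      ... | if-ff p y with _ , refl , z ← ext-δret y with δ d' ← d =
        if-ff p (eval⇒⇓ N sf (≤-trans (n≤1+n _) n≤N) z d')
      eval⇒⇓ N (while e sₜ) n≤N x d with J⊆ x
      ... | while-ff p eq with refl ← ↘-functional d (≈δret⇒↘ eq) = while-ff p
      ... | while-tt p y z with _ , refl , w ← ext-δret y
        -- The δ of the guard heads both the result of the body and that of the loop, so both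
        -- counts, and hence `N`, are successors.
        with _ , _ , δ d₀ , s≤s m≤n ← ext-↘⁻¹ z d with N | n≤N
      ... | suc N | s≤s n≤N
        with eval⇒⇓ (suc N) sₜ (≤-trans m≤n (≤-trans n≤N (n≤1+n N))) w d₀ | ext-↘ z (δ d₀)
      -- That δ is already spent when the loop restarts, so the remaining delays fit the smaller
      -- bound.
      ... | ih | ret q u with _ , d₁ , refl ← ↠-↘⁻¹ q d =
        while-ret p ih (eval⇒⇓ N (while e sₜ) (≤-trans (m≤n+m _ _) n≤N) u d₁)
      ... | ih | inp d' u with refl ← ↘-functional d d' = while-inp p ih (λ v → ext⇒Norm (u v))
      ... | ih | out d' u with refl ← ↘-functional d d' = while-out p ih (ext⇒Norm u)

      -- For a composition or a loop, excluded middle on the intermediate resumption decides whether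
      -- the first component diverges or what follows it does.
      eval⇒⇑ : ∀ {s σ r} → J (eval s σ r) → ¬ Converges r → Norm ⊢⟨ s , σ ⟩⇑
      eval⇒⇑ x ¬c = coind D step (-, x , ¬c)
        where
        D : Pred (Stmt × State) 0ℓ
        D (s , σ) = ∃[ r ] (J (eval s σ r) × ¬ Converges r)

        step : D ⊆ Diverge Norm D
        step {s , σ} (r , x , ¬c) with J⊆ x
        ... | assign eq = ⊥-elim (¬c (-, -, ≈δret⇒↘ eq))
        ... | while-ff p eq = ⊥-elim (¬c (-, -, ≈δret⇒↘ eq))
        ... | skip = ⊥-elim (¬c (-, -, ret))
        ... | input (coind R R⊆ Rr) with inp _ ← R⊆ Rr = ⊥-elim (¬c (-, -, inp))
        ... | output (coind R R⊆ Rr) with out _ ← R⊆ Rr = ⊥-elim (¬c (-, -, out))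
        ... | if-tt p y with _ , refl , z ← ext-δret y =
          if-tt p (-, z , ¬Converges-force ¬c)
        ... | if-ff p y with _ , refl , z ← ext-δret y =
          if-ff p (-, z , ¬Converges-force ¬c)
        ... | seq {r = r₀} y z with em (Converges r₀)
        ... | no ¬c₀ = seq₀ (-, y , ¬c₀)
        ... | yes (_ , _ , d) with _ , _ , refl , w , ¬c₁ ← ¬Converges-after z d ¬c =
          seq₁ (eval⇒⇓ _ _ ≤-refl y d) (-, w , ¬c₁)
        step {s , σ} (r , x , ¬c) | while-tt p y z with t , refl , w ← ext-δret y
          with em (Converges (force t))
        ... | no ¬c₀ = while₀ p (-, w , ¬c₀)
        ... | yes (_ , _ , d) with _ , _ , refl , u , ¬c₁ ← ¬Converges-after z (δ d) ¬c =
          while₁ p (eval⇒⇓ _ _ ≤-refl w d) (-, u , ¬c₁)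

      -- If `q` shows no head, neither does `q'`, and the rule for `•` applies. Otherwise the head
      -- of `q` selects the rule, `Norm` itself serving as the `X` of the two `ret` rules.
      Norm⊆Extᶜ : Norm ⊆ Extᶜ Norm
      Norm⊆Extᶜ x with q , _ , j , e , e' ← toWitness x with em (Converges q)
      ... | no ¬c = silent e (≈ᶜ-trans (≈ᶜ-reflexive (sym (norm-¬Converges ¬c'))) e')
        where
        ¬c' = λ (_ , _ , d) → let _ , _ , d' , _ = ext-↘⁻¹ j d in ¬c (-, -, d')
        silent : ∀ {s r r'} → • ≈ᶜ r → • ≈ᶜ r' → Extᶜ Norm ((s , r) , r')
        silent (coind R R⊆ Rr) (coind S S⊆ Sr) with • ← R⊆ Rr with • ← S⊆ Sr = •
      ... | yes (_ , _ , d) = observable (ext-↘ j d) e e'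
        where
        evaluated : ∀ {s σ q' r'} → J (eval s σ q') → norm q' ≈ᶜ r' →
                    Extᶜ Norm ((s , ret σ) , r')
        evaluated {q' = q'} x e' with em (Converges q')
        ... | yes (_ , _ , d) = ret⇓ Norm Norm-resp (λ z → z)
          (⇓-resp-≈ᶜ Norm-resp e' (eval⇒⇓ _ _ ≤-refl x d))
        ... | no ¬c with coind S S⊆ Sr ← e' with • ← S⊆ Sr =
          ret⇑ Norm Norm-resp (λ z → z) (eval⇒⇑ x ¬c)

        observable : ∀ {s m h q' r r'} → AfterHead s m h q' → observe h ≈ᶜ r →
                     norm q' ≈ᶜ r' → Extᶜ Norm ((s , r) , r')
        observable (ret p y) (coind R R⊆ Rr) e' with ret ← R⊆ Rr =
          -- The delays spent before `s` starts are invisible to `norm`.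
          evaluated y (≈ᶜ-trans (≈ᶜ-reflexive (sym (norm-↠ p))) e')
        observable (inp d y) (coind R R⊆ Rr) e'
          with coind S S⊆ Sr ← ≈ᶜ-trans (≈ᶜ-reflexive (sym (norm-↘ d))) e'
          with inp g ← R⊆ Rr with inp g' ← S⊆ Sr =
          inp (λ v → Norm-resp (coind R R⊆ (g v)) (coind S S⊆ (g' v)) (ext⇒Norm (y v)))
        observable (out d y) (coind R R⊆ Rr) e'
          with coind S S⊆ Sr ← ≈ᶜ-trans (≈ᶜ-reflexive (sym (norm-↘ d))) e'
          with out g ← R⊆ Rr with out g' ← S⊆ Sr =
          out (Norm-resp (coind R R⊆ g) (coind S S⊆ g') (ext⇒Norm y))

      Norm⊆⇒* : Norm ⊆ ⇒*
      Norm⊆⇒* x = coind Norm Norm⊆Extᶜ x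

      -- Both evaluations are monotone in their relation, so `Norm` may be enlarged to `⇒*`.
      eval⇒norm : ∀ {s σ r} → J (eval s σ r) → ⟨ s , σ ⟩⇒ᶜ norm r
      eval⇒norm {s} {σ} {r} x with em (Converges r)
      ... | yes (_ , _ , d) = conv (⇓-mono Norm⊆⇒* (eval⇒⇓ _ _ ≤-refl x d))
      ... | no ¬c           = div (⇑-mono Norm⊆⇒* (eval⇒⇑ x ¬c))

corollary7p1 : ExcludedMiddle 1ℓ →
    (L : Language) → let open Semantics L in
    ∀ (s : Stmt) (σ : State) (r : Res) → ⟨ s , σ ⟩⇒ r →
    ∃[ r' ] (⟨ s , σ ⟩⇒ᶜ r' × r ≅ emb r')
corollary7p1 lem L s σ r (coind J J⊆ x) =
  norm L lem r , eval⇒norm L lem J J⊆ x , ≅-emb-norm L lem r
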